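{- Let $(P_i)_{i\in I}$ be any family of nonempty countable meet-continuous dcpos, each of which is an $L$-dcpo. Then \[ \sigma\Bigl(\prod_{i\in I}P_i\Bigr)=\prod_{i\in I}\sigma(P_i) \] holds if and only if the set $I_0=\{i\in I:P_i\text{ has no least element}\}$ is finite. Neither $I$ nor the whole product is required to be countable. Moreover, the necessity of the finiteness condition holds for arbitrary nonempty $L$-dcpos: if $(P_i)_{i\in I}$ is any family of nonempty $L$-dcpos (with no countability or meet-continuity assumption) satisfying the displayed equality, then $I_0$ is finite.
   Context: Directed sets are nonempty; countable sets may be finite; arbitrary products are taken in the usual set theory with choice. A subset $D$ of a poset is directed if any two of its elements have a common upper bound in $D$. A dcpo is a poset in which every directed subset has a supremum. Write $\mathord{\downarrow}x=\{y:y\le x\}$ and $\mathord{\downarrow}A=\bigcup_{a\in A}\mathord{\downarrow}a$. For a dcpo $P$, an upper set $U\subseteq P$ is Scott open if for every directed $D\subseteq P$, $\bigvee D\in U$ implies $D\cap U\neq\emptyset$; the Scott open sets form the Scott topology $\sigma(P)$. A dcpo $P$ is meet-continuous if for every $x\in P$ and every directed $D\subseteq P$, $x\le\bigvee D$ implies $x\in\operatorname{cl}_{\sigma(P)}(\mathord{\downarrow}x\cap\mathord{\downarrow}D)$, where $\operatorname{cl}_{\sigma(P)}$ is closure in the Scott topology. A dcpo $P$ is an $L$-dcpo if every principal ideal $\mathord{\downarrow}r$, $r\in P$, is a complete lattice in its induced order (suprema and infima of all subsets, including the empty one, exist inside $\mathord{\downarrow}r$). A global least element is not required. $\prod_i P_i$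 carries the coordinatewise order, $\sigma(\prod_i P_i)$ is its Scott topology, and $\prod_i\sigma(P_i)$ denotes the ordinary topological (Tychonoff) product of the Scott topologies. -}

module Defs where

open import Data.List.Base using (List)
open import Data.List.Membership.Propositional using () renaming (_∈_ to _∈ₗ_)
open import Data.Nat.Base using (ℕ)
open import Data.Product.Base using (Σ; Σ-syntax; ∃; ∃-syntax; _×_; _,_; proj₁; proj₂)
open import Function.Bundles using (Injection; _⇔_)
open import Level using (Level; suc)
open import Relation.Binary.Bundles using (Poset)
open import Relation.Binary.Definitions using (Minimum)
open import Relation.Binary.PropositionalEquality.Properties using (setoid)
open import Relation.Nullary.Negation.Core using (¬_)
open import Relation.Unary
  using (Pred; _∈_; _⊆_; _∩_; _≬_; ∁; Satisfiable; Universal)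
import Relation.Binary.Construct.On as On

private
  variable
    ℓ : Level

-- Everything lives at one universe level ℓ, so that Pred X ℓ plays the role of
-- the power set of a carrier X.  Posets carry a setoid equality, as in the
-- standard library; subsets are arbitrary predicates (they need not respect
-- that equality, but lower sets, upper sets and suprema do).

module _ (P : Poset ℓ ℓ ℓ) where
  open Poset P using (Carrier; _≤_; module Eq)

  ↓ : Carrier → Pred Carrier ℓ
  ↓ x = λ y → y ≤ x

  ↓ˢ : Pred Carrier ℓ → Pred Carrier ℓ
  ↓ˢ A = λ y → ∃[ a ] a ∈ A × y ≤ a

  record IsSup (A : Pred Carrier ℓ) (s : Carrier) : Set ℓ where
    field
      upper : ∀ {a} → a ∈ A → a ≤ s
      least : ∀ {u} → (∀ {a} → a ∈ A → a ≤ u) → s ≤ u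

  record IsInf (A : Pred Carrier ℓ) (m : Carrier) : Set ℓ where
    field
      lower    : ∀ {a} → a ∈ A → m ≤ a
      greatest : ∀ {l} → (∀ {a} → a ∈ A → l ≤ a) → l ≤ m

  record IsDirected (D : Pred Carrier ℓ) : Set ℓ where
    field
      nonempty : Satisfiable D
      bounded  : ∀ {x y} → x ∈ D → y ∈ D → ∃[ z ] z ∈ D × x ≤ z × y ≤ z

  IsDcpo : Set (suc ℓ)
  IsDcpo = ∀ D → IsDirected D → ∃ (IsSup D)

  IsCompleteLattice : Set (suc ℓ)
  IsCompleteLattice = ∀ A → ∃ (IsSup A) × ∃ (IsInf A)

  principalIdeal : Carrier → Poset ℓ ℓ ℓ
  principalIdeal r = On.poset P (proj₁ {A = Carrier} {B = ↓ r})

module _ (P : Poset ℓ ℓ ℓ) where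
  open Poset P using (Carrier; _≤_; module Eq)

  record IsLDcpo : Set (suc ℓ) where
    field
      isDcpo         : IsDcpo P
      idealsComplete : ∀ r → IsCompleteLattice (principalIdeal P r)

  -- The Scott topology σ(P) is the predicate ScottOpen on subsets of P.
  -- Quantifying over all suprema s of D, instead of a chosen ⋁ D, makes sense
  -- for every poset; in a dcpo the two agree since s is unique up to ≈.
  record ScottOpen (U : Pred Carrier ℓ) : Set (suc ℓ) where
    field
      upperSet     : ∀ {x y} → x ∈ U → x ≤ y → y ∈ U
      inaccessible : ∀ D s → IsDirected P D → IsSup P D s → s ∈ U → D ≬ U

  ScottClosed : Pred Carrier ℓ → Set (suc ℓ)
  ScottClosed C = ScottOpen (∁ C)

  ScottClosure : Pred Carrier ℓ → Pred Carrier (suc ℓ)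
  ScottClosure A = λ x → ∀ C → ScottClosed C → A ⊆ C → x ∈ C

  record IsMeetContinuousDcpo : Set (suc ℓ) where
    field
      isDcpo         : IsDcpo P
      meetContinuous : ∀ x D s → IsDirected P D → IsSup P D s → x ≤ s →
                       x ∈ ScottClosure (↓ P x ∩ ↓ˢ P D)

  IsCountable : Set ℓ
  IsCountable = Injection Eq.setoid (setoid ℕ)

  HasLeast : Set ℓ
  HasLeast = ∃ (Minimum _≤_)

IsFinite : {X : Set ℓ} → Pred X ℓ → Set ℓ
IsFinite {X = X} A = Σ[ xs ∈ List X ] (∀ x → x ∈ A ⇔ x ∈ₗ xs)

ΠPoset : {I : Set ℓ} → (I → Poset ℓ ℓ ℓ) → Poset ℓ ℓ ℓ
ΠPoset {I = I} P = record
  { Carrier = ∀ i → Carrier (P i)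
  ; _≈_     = λ x y → ∀ i → _≈_ (P i) (x i) (y i)
  ; _≤_     = λ x y → ∀ i → _≤_ (P i) (x i) (y i)
  ; isPartialOrder = record
    { isPreorder = record
      { isEquivalence = record
        { refl  = λ i → Eq.refl (P i)
        ; sym   = λ p i → Eq.sym (P i) (p i)
        ; trans = λ p q i → Eq.trans (P i) (p i) (q i)
        }
      ; reflexive = λ p i → reflexive (P i) (p i)
      ; trans     = λ p q i → trans (P i) (p i) (q i)
      }
    ; antisym = λ p q i → antisym (P i) (p i) (q i)
    }
  }
  where open Poset

-- The Tychonoff product of the topologies τ i (given by their open sets):
-- unions of boxes ∏ᵢ V i with every V i open and {i | V i ≠ X i} finite.
ProductOpen : {I : Set ℓ} {X : I → Set ℓ} →
              (∀ i → Pred (Pred (X i) ℓ) (suc ℓ)) →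
              Pred (Pred (∀ i → X i) ℓ) (suc ℓ)
ProductOpen {ℓ = ℓ} {X = X} τ U =
  ∀ x → x ∈ U →
  Σ[ V ∈ (∀ i → Pred (X i) ℓ) ]
    (∀ i → V i ∈ τ i) ×
    IsFinite (λ i → ¬ Universal (V i)) ×
    (∀ i → x i ∈ V i) ×
    (∀ y → (∀ i → y i ∈ V i) → y ∈ U)

NoLeast : {I : Set ℓ} → (I → Poset ℓ ℓ ℓ) → Pred I ℓ
NoLeast P = λ i → ¬ HasLeast (P i)

{-# OPTIONS --safe #-}
-- Necessity.  In an L-dcpo, if the bottom b of some ideal lies below y, then it lies
-- below everything that y dominates.  So in the product {y | m ≤ y} is Scott open
-- for a family m of such bottoms.  A box around m inside it forces
-- m i to be least in P i for all but finitely many i.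
--
-- Sufficiency.  Let U be Scott open in the product and x ∈ U.  Replacing x by least
-- elements outside a finite F ⊇ I₀ keeps it in U.  Build u₀ ≥ u₁ ≥ … in U, moving
-- only coordinates in F, and let V i be the filter generated by the u n i.  The V i
-- span a box inside U; the point is to make each V i Scott open although there
-- may be uncountably many directed sets.  It suffices to meet the countably many
-- requirements (s , d , μ): if some directed D with supremum s contains d but no
-- element above μ, then V i contains some m with d ≤ m ≤ s and μ ≰ m.
-- Meet-continuity lets a single step meet any one of them.  If D then had its
-- supremum s in V i but missed V i, the requirements would yield sequences m, z
-- below s with z k ≰ m k but z k ≤ m j for all j ≠ k; the infima of the subfamilies
-- of m would be 2^ω distinct elements of a countable poset.
module Submission where

open import Defs
open import Axiom.DoubleNegationElimination using (em⇒dne)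
open import Axiom.ExcludedMiddle using (ExcludedMiddle)
open import Data.Bool.Base using (Bool; true; false)
open import Data.Empty using (⊥)
open import Data.List.Base using (List; []; _∷_; _++_; filter; upTo; cartesianProduct)
open import Data.List.Membership.Propositional using () renaming (_∈_ to _∈ₗ_)
open import Data.List.Membership.Propositional.Properties
  using (∈-filter⁺; ∈-filter⁻; ∈-++⁺ˡ; ∈-++⁺ʳ; ∈-upTo⁺; ∈-cartesianProduct⁺)
open import Data.List.Relation.Unary.Any using (here; there)
import Data.Nat.Base as ℕ
open ℕ using (ℕ; _⊔_; _≤′_; ≤′-refl; ≤′-step)
open import Data.Nat.Properties as ℕₚ using (<-cmp; ≤⇒≤′; m≤m⊔n; m≤n⊔m)
open import Data.Product.Base using (Σ-syntax; ∃; ∃-syntax; _×_; _,_; proj₁; proj₂)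
open import Function.Base using (_∘_)
open import Function.Bundles using (Injection; Equivalence; _⇔_; mk⇔)
open import Level using (Level; Lift)
open import Relation.Binary.Bundles using (Poset)
open import Relation.Binary.Definitions using (tri<; tri≈; tri>)
open import Relation.Binary.PropositionalEquality.Core
  using (_≡_; _≢_; refl; sym; trans; subst)
open import Relation.Nullary.Decidable.Core using (Dec; yes; no; does)
open import Relation.Nullary.Negation.Core using (¬_; contradiction)
open import Relation.Unary using (Pred; _∈_; _≐_; _⊆_; Universal)

open Poset using (Carrier)

module _ (em : ∀ {a} → ExcludedMiddle a) where

  private
    variable
      a ℓ : Level

  -- Classical reasoning, finite subsets, and changes of one coordinate.

  byContradiction : {A : Set a} → ¬ ¬ A → A
  byContradiction = em⇒dne em

  subset-finite : {X : Set ℓ} {A : Pred X ℓ} (xs : List X) →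
                  (∀ {x} → x ∈ A → x ∈ₗ xs) → IsFinite A
  subset-finite {A = A} xs A⊆xs = filter A? xs , λ x →
    mk⇔ (λ x∈A → ∈-filter⁺ A? (A⊆xs x∈A) x∈A) (proj₂ ∘ ∈-filter⁻ A? {xs = xs})
    where
    A? : ∀ x → Dec (A x)
    A? x = em

  module _ {I : Set ℓ} {X : I → Set ℓ} where

    update : (∀ j → X j) → ∀ i → X i → ∀ j → X j
    update u i z j with em {P = i ≡ j}
    ... | yes refl = z
    ... | no _     = u j

    update-self : ∀ u i z → update u i z i ≡ z
    update-self u i z with em {P = i ≡ i}
    ... | yes refl = refl
    ... | no i≢i   = contradiction refl i≢i

    update-elim₂ : ∀ {q} (Q : ∀ j → X j → X j → Set q) {u v i z w} →
                   Q i z w → (∀ j → Q j (u j) (v j)) →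
                   ∀ j → Q j (update u i z j) (update v i w j)
    update-elim₂ Q {i = i} zw uv j with em {P = i ≡ j}
    ... | yes refl = zw
    ... | no _     = uv j

    update-elim : ∀ {q} (Q : ∀ j → X j → Set q) {u i z} →
                  Q i z → (∀ j → Q j (u j)) → ∀ j → Q j (update u i z j)
    update-elim Q {u} {i} {z} = update-elim₂ (λ j p _ → Q j p) {v = u} {w = z}

  -- Scott open sets, ideals and independent sequences in a single poset.

  module _ (P : Poset ℓ ℓ ℓ) where
    open Poset P using (_≤_) renaming (refl to ≤-refl; trans to ≤-trans)

    not-below-open : ∀ m → ScottOpen P (λ z → ¬ z ≤ m)
    not-below-open m = record
      { upperSet     = λ x≰m x≤y y≤m → x≰m (≤-trans x≤y y≤m)
      ; inaccessible = λ D s dir sup s≰m → byContradiction λ D≬̸ →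
          s≰m (IsSup.least sup λ {d} d∈D → byContradiction λ d≰m → D≬̸ (d , d∈D , d≰m))
      }

    -- The complement of `W` is Scott closed; if it contained `↓x ∩ ↓D`, it would contain the
    -- closure and with it `x`. This form supplies the elements `z` both of the independent sequence
    -- and of the descent inside `U`.
    meet-inaccessible : IsMeetContinuousDcpo P → ∀ {W x D s} → ScottOpen P W →
                        IsDirected P D → IsSup P D s → x ∈ W → x ≤ s →
                        ∃[ z ] z ∈ W × z ≤ x × ∃[ d ] d ∈ D × z ≤ d
    meet-inaccessible mc {W} {x} {D} {s} Wopen dir sup x∈W x≤s = byContradiction λ none →
      IsMeetContinuousDcpo.meetContinuous mc x D s dir sup x≤s
        (λ z → ¬ z ∈ W) closed
        (λ (z≤x , z≤D) z∈W → none (_ , z∈W , z≤x , z≤D)) x∈W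
      where
      closed : ScottClosed P (λ z → ¬ z ∈ W)
      closed = record
        { upperSet     = λ ¬¬x∈W x≤y y∉W → ¬¬x∈W λ x∈W → y∉W (ScottOpen.upperSet Wopen x∈W x≤y)
        ; inaccessible = λ D s dir sup ¬¬s∈W →
            let d , d∈D , d∈W = ScottOpen.inaccessible Wopen D s dir sup (byContradiction ¬¬s∈W)
            in d , d∈D , λ d∉W → d∉W d∈W
        }

    -- The witness is the bottom of `↓r`. If `c` is the bottom of `↓y`, then `c ≤ b ≤ r` gives
    -- `b ≤ c`, while `c ≤ x`.
    ideal-bottom-minimal : IsLDcpo P → ∀ r →
                           ∃[ b ] b ≤ r × (∀ {x y} → b ≤ y → x ≤ y → b ≤ x)
    ideal-bottom-minimal L r = proj₁ (bot r) , proj₁ (proj₂ (bot r)) , λ {x} {y} b≤y x≤y →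
      let c , c≤y , c-least = bot y in
      ≤-trans (proj₂ (proj₂ (bot r)) (≤-trans (c-least b≤y) (proj₁ (proj₂ (bot r)))))
              (c-least x≤y)
      where
      bot : ∀ y → ∃[ b ] b ≤ y × (∀ {x} → x ≤ y → b ≤ x)
      bot y =
        let ((b , b≤y) , sup) , _ = IsLDcpo.idealsComplete L y (λ _ → Lift _ ⊥)
        in b , b≤y , λ {x} x≤y → IsSup.least sup {x , x≤y} λ ()

    -- The infima of the subfamilies of m are pairwise distinct, so Cantor's
    -- diagonal applies to (subset of ℕ) ↦ (code of the infimum).
    no-independent-sequence :
      IsCountable P → IsLDcpo P → ∀ {s} (m z : ℕ → Carrier P) →
      (∀ i → m i ≤ s) → (∀ i → z i ≤ s) →
      (∀ i → ¬ z i ≤ m i) → (∀ {i j} → i ≢ j → z i ≤ m j) → ⊥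
    no-independent-sequence count L {s} m z m≤s z≤s z≰m z≤m = T-diagonal (em {P = Diag (f T)})
      where
      open Injection count using (to; injective)

      Family : (ℕ → Bool) → Pred (Carrier (principalIdeal P s)) _
      Family S (p , _) = ∃[ i ] S i ≡ true × p ≡ m i

      inf : ∀ S → ∃ (IsInf (principalIdeal P s) (Family S))
      inf S = proj₂ (IsLDcpo.idealsComplete L s (Family S))

      ⋀ : (ℕ → Bool) → Carrier P
      ⋀ S = proj₁ (proj₁ (inf S))

      ⋀-lower : ∀ {S i} → S i ≡ true → ⋀ S ≤ m i
      ⋀-lower {S} {i} Si = IsInf.lower (proj₂ (inf S)) {m i , m≤s i} (i , Si , refl)

      ⋀-above : ∀ {S i} → S i ≡ false → z i ≤ ⋀ S
      ⋀-above {S} {i} Si = IsInf.greatest (proj₂ (inf S)) {z i , z≤s i}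
        -- Since `S i` is false, a member `m j` of the family has `j ≢ i` and so lies above `z i`.
        λ { (j , Sj , refl) → z≤m λ { refl → contradiction (trans (sym Sj) Si) λ () } }

      f : (ℕ → Bool) → ℕ
      f S = to (⋀ S)

      separated : ∀ {S T i} → f S ≡ f T → S i ≡ false → T i ≡ true → ⊥
      separated eq Si Ti =
        z≰m _ (≤-trans (⋀-above Si) (≤-trans (Poset.reflexive P (injective eq)) (⋀-lower Ti)))

      -- The sets with code `n` are quantified over instead of inverting `f`. If `Diag (f T)` holds,
      -- some `S` with the code of `T` omits `f T` while `T` contains it; if not, `T` itself is a
      -- witness.
      Diag : ℕ → Set
      Diag n = ∃[ S ] f S ≡ n × S n ≡ false

      T : ℕ → Bool
      T n = does (em {P = Diag n})

      T-diagonal : Dec (Diag (f T)) → ⊥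
      T-diagonal (yes (S , eq , Sn)) = separated eq Sn T-true
        where
        T-true : T (f T) ≡ true
        T-true with em {P = Diag (f T)}
        ... | yes _ = refl
        ... | no ¬d = contradiction (S , eq , Sn) ¬d
      T-diagonal (no ¬d) = ¬d (T , refl , T-false)
        where
        T-false : T (f T) ≡ false
        T-false with em {P = Diag (f T)}
        ... | yes d = contradiction d ¬d
        ... | no _  = refl

    -- `D` is quantified away, so a requirement depends on three elements only, and countability of
    -- `P` leaves countably many.
    Avoidable : (s d μ : Carrier P) → Set _
    Avoidable s d μ = ∃[ D ] IsDirected P D × IsSup P D s × d ∈ D × (∀ {e} → e ∈ D → ¬ μ ≤ e)

    Avoids : (s d μ m : Carrier P) → Set _
    Avoids s d μ m = d ≤ m × m ≤ s × ¬ μ ≤ m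

    -- Scott openness of filters that meet all avoidance requirements.

    module _ (count : IsCountable P) (mc : IsMeetContinuousDcpo P) (L : IsLDcpo P)
             {V : Pred (Carrier P) ℓ}
             (V-upper : ∀ {x y} → x ∈ V → x ≤ y → y ∈ V)
             (V-filtered : ∀ {x y} → x ∈ V → y ∈ V → ∃[ z ] z ∈ V × z ≤ x × z ≤ y)
             (V-avoids : ∀ {s d μ} → s ∈ V → Avoidable s d μ → ∃[ m ] m ∈ V × Avoids s d μ m)
      where

      module _ {D s} (dir : IsDirected P D) (sup : IsSup P D s) (s∈V : s ∈ V)
               (D∩V=∅ : ∀ {e} → e ∈ D → ¬ e ∈ V) where

        -- `μ` will descend in `V` and `d` ascend in `D`. Each new `m` lies above both `d` and the
        -- next `μ`, each new `z` below both `μ` and the next `d`.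
        record State : Set ℓ where
          field
            μ d : Carrier P
            μ∈V : μ ∈ V
            μ≤s : μ ≤ s
            d∈D : d ∈ D

        open State

        record Step (σ : State) : Set ℓ where
          field
            m z     : Carrier P
            next    : State
            d≤m     : d σ ≤ m
            m≤s     : m ≤ s
            z≰m     : ¬ z ≤ m
            z≤μ     : z ≤ μ σ
            z≤next  : z ≤ d next
            d≤next  : d σ ≤ d next
            next≤μ  : μ next ≤ μ σ
            next≤m  : μ next ≤ m

        step : ∀ σ → Step σ
        step σ =
          -- `V` is an upper set that misses `D`, so no element of `D` is above `μ σ`, and `D`
          -- itself makes the triple avoidable.
          let m , m∈V , d≤m , m≤s , μ≰m = V-avoids s∈V
                (D , dir , sup , d∈D σ , λ e∈D μ≤e → D∩V=∅ e∈D (V-upper (μ∈V σ) μ≤e))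
              -- The open set of elements not below `m` contains `μ σ`, which lies below the
              -- supremum of `D`.
              z , z≰m , z≤μ , e , e∈D , z≤e =
                meet-inaccessible mc (not-below-open m) dir sup μ≰m (μ≤s σ)
              d′ , d′∈D , d≤d′ , e≤d′ = IsDirected.bounded dir (d∈D σ) e∈D
              μ′ , μ′∈V , μ′≤μ , μ′≤m = V-filtered (μ∈V σ) m∈V
          in record
            { m = m ; z = z
            ; next = record
                { μ = μ′ ; d = d′ ; μ∈V = μ′∈V ; μ≤s = ≤-trans μ′≤μ (μ≤s σ) ; d∈D = d′∈D }
            ; d≤m = d≤m ; m≤s = m≤s ; z≰m = z≰m ; z≤μ = z≤μ
            ; z≤next = ≤-trans z≤e e≤d′ ; d≤next = d≤d′ ; next≤μ = μ′≤μ ; next≤m = μ′≤m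
            }

        state : ℕ → State
        state ℕ.zero    = record
          { μ = s ; d = proj₁ (IsDirected.nonempty dir) ; μ∈V = s∈V ; μ≤s = ≤-refl
          ; d∈D = proj₂ (IsDirected.nonempty dir) }
        state (ℕ.suc n) = Step.next (step (state n))

        module At n = Step (step (state n))

        d-mono : ∀ {i j} → i ≤′ j → d (state i) ≤ d (state j)
        d-mono ≤′-refl           = ≤-refl
        d-mono (≤′-step {n} i≤n) = ≤-trans (d-mono i≤n) (At.d≤next n)

        μ-anti : ∀ {i j} → i ≤′ j → μ (state j) ≤ μ (state i)
        μ-anti ≤′-refl           = ≤-refl
        μ-anti (≤′-step {n} i≤n) = ≤-trans (At.next≤μ n) (μ-anti i≤n)

        -- An earlier `z` gets below `m j` through the ascending `d`, a later one through the
        -- descending `μ`.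
        z≤m-off-diagonal : ∀ {i j} → i ≢ j → At.z i ≤ At.m j
        z≤m-off-diagonal {i} {j} i≢j with <-cmp i j
        ... | tri< i<j _ _ = ≤-trans (At.z≤next i) (≤-trans (d-mono (≤⇒≤′ i<j)) (At.d≤m j))
        ... | tri≈ _ i≡j _ = contradiction i≡j i≢j
        ... | tri> _ _ j<i = ≤-trans (At.z≤μ i) (≤-trans (μ-anti (≤⇒≤′ j<i)) (At.next≤m j))

        disjoint-absurd : ⊥
        disjoint-absurd = no-independent-sequence count L At.m At.z At.m≤s
          (λ i → ≤-trans (At.z≤μ i) (μ≤s (state i))) At.z≰m z≤m-off-diagonal

      avoiding-filter-open : ScottOpen P V
      avoiding-filter-open = record
        { upperSet     = V-upper
        ; inaccessible = λ D s dir sup s∈V → byContradiction λ D≬̸V →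
            disjoint-absurd dir sup s∈V λ e∈D e∈V → D≬̸V (_ , e∈D , e∈V)
        }

  -- Slices and boxes in a product.

  module _ {I : Set ℓ} (P : I → Poset ℓ ℓ ℓ) where
    private
      module Π = Poset (ΠPoset P)
      module P i = Poset (P i)
      open Π using (_≤_)

    -- The map `update u i` preserves directed suprema.
    slice-open : ∀ {U} → ScottOpen (ΠPoset P) U → ∀ u i →
                 ScottOpen (P i) (λ z → update u i z ∈ U)
    slice-open {U} Uopen u i = record
      { upperSet     = λ x∈U x≤y → upperSet x∈U (slice-mono x≤y)
      ; inaccessible = λ D s dir sup s∈U →
          let open IsDirected dir
              w , (d , d∈D , eq) , w∈U = inaccessible
                (λ w → ∃[ d ] d ∈ D × w ≡ update u i d) (update u i s)
                (record
                  { nonempty = let d , d∈D = nonempty in _ , d , d∈D , refl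
                  ; bounded  = λ { (_ , x∈D , refl) (_ , y∈D , refl) →
                      let z , z∈D , x≤z , y≤z = bounded x∈D y∈D
                      in _ , (z , z∈D , refl) , slice-mono x≤z , slice-mono y≤z } })
                (record
                  { upper = λ { (_ , d∈D , refl) → slice-mono (IsSup.upper sup d∈D) }
                  ; least = λ {v} above j →
                      -- Away from `i` every updated point agrees with `u`, so the bound given by
                      -- any one member of `D` suffices there.
                      let d₀ , d₀∈D = nonempty
                          s-below-v = IsSup.least sup λ {d} d∈D →
                            subst (λ p → P._≤_ i p (v i)) (update-self u i d) (above (d , d∈D , refl) i)
                      in update-elim₂ (λ j p q → P._≤_ j q (v j) → P._≤_ j p (v j))
                           {u} {u} {i} {s} {d₀} (λ _ → s-below-v) (λ _ q≤v → q≤v) j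
                           (above (d₀ , d₀∈D , refl) j) })
                s∈U
          in d , d∈D , subst U eq w∈U
      }
      where
      open ScottOpen Uopen
      slice-mono : ∀ {x y} → P._≤_ i x y → update u i x ≤ update u i y
      slice-mono x≤y = update-elim₂ P._≤_ x≤y (λ j → P.refl j)

    -- Each projection of `D` is directed with supremum `s i`, hence meets `V i`; directedness
    -- merges the witnesses for the finitely many constrained coordinates.
    productOpen⇒scottOpen : ProductOpen (λ i → ScottOpen (P i)) ⊆ ScottOpen (ΠPoset P)
    productOpen⇒scottOpen {U} Uopen = record
      { upperSet     = λ {x} {y} x∈U x≤y →
          let _ , V-open , _ , x∈V , box⊆U = Uopen x x∈U
          in box⊆U y λ i → ScottOpen.upperSet (V-open i) (x∈V i) (x≤y i)
      ; inaccessible = λ D s dir sup s∈U →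
          let V , V-open , (xs , fin) , s∈V , box⊆U = Uopen s s∈U
              d , d∈D , d∈V = meets-finitely-many dir V-open xs λ i →
                let p , (d , d∈D , eq) , p∈V = ScottOpen.inaccessible (V-open i)
                      (projection D i) (s i) (projection-directed dir i)
                      (projection-sup sup i) (s∈V i)
                in d , d∈D , subst (V i) eq p∈V
          in d , d∈D , box⊆U d λ i → byContradiction λ d∉V →
               d∉V (d∈V (Equivalence.to (fin i) λ univ → d∉V (univ (d i))))
      }
      where
      projection : Pred Π.Carrier ℓ → ∀ i → Pred (P.Carrier i) ℓ
      projection D i p = ∃[ d ] d ∈ D × p ≡ d i

      projection-directed : ∀ {D} → IsDirected (ΠPoset P) D → ∀ i → IsDirected (P i) (projection D i)
      projection-directed dir i = record
        { nonempty = let d , d∈D = nonempty in d i , d , d∈D , refl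
        ; bounded  = λ { (_ , x∈D , refl) (_ , y∈D , refl) →
            let z , z∈D , x≤z , y≤z = bounded x∈D y∈D
            in z i , (z , z∈D , refl) , x≤z i , y≤z i }
        }
        where open IsDirected dir

      -- An upper bound `v` of the projection extends to the upper bound `update s i v` of `D`.
      projection-sup : ∀ {D s} → IsSup (ΠPoset P) D s → ∀ i → IsSup (P i) (projection D i) (s i)
      projection-sup {D} {s} sup i = record
        { upper = λ { (_ , d∈D , refl) → IsSup.upper sup d∈D i }
        ; least = λ {v} above →
            subst (P._≤_ i (s i)) (update-self s i v)
              (IsSup.least sup (λ {d} d∈D → update-elim (λ j → P._≤_ j (d j))
                (above (d , d∈D , refl)) (IsSup.upper sup d∈D)) i)
        }

      meets-finitely-many :
        ∀ {D} {V : ∀ i → Pred (P.Carrier i) ℓ} →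
        IsDirected (ΠPoset P) D → (∀ i → ScottOpen (P i) (V i)) → ∀ xs →
        (∀ i → ∃[ d ] d ∈ D × d i ∈ V i) →
        ∃[ d ] d ∈ D × (∀ {i} → i ∈ₗ xs → d i ∈ V i)
      meets-finitely-many dir V-open [] each =
        let d , d∈D = IsDirected.nonempty dir in d , d∈D , λ ()
      meets-finitely-many dir V-open (i ∷ xs) each =
        let d , d∈D , d∈V  = meets-finitely-many dir V-open xs each
            e , e∈D , e∈Vi = each i
            c , c∈D , d≤c , e≤c = IsDirected.bounded dir d∈D e∈D
        in c , c∈D , λ { (here refl) → ScottOpen.upperSet (V-open i) e∈Vi (e≤c i)
                       ; (there j∈xs) → ScottOpen.upperSet (V-open _) (d∈V j∈xs) (d≤c _) }

    -- Necessity of the finiteness condition.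

    noLeast-finite : (∀ i → P.Carrier i) → (∀ i → IsLDcpo (P i)) →
                     ScottOpen (ΠPoset P) ≐ ProductOpen (λ i → ScottOpen (P i)) →
                     IsFinite (NoLeast P)
    noLeast-finite p L σ≐τ =
      let V , _ , (xs , fin) , m∈V , box⊆U = proj₁ σ≐τ U-open m (λ i → P.refl i)
      -- Where `V i` is everything, coordinate `i` of `m` can become any `y` without leaving the
      -- box, so `m i` would be least.
      in subset-finite xs λ {i} none → Equivalence.to (fin i) λ univ →
           none (m i , λ y → subst (P._≤_ i (m i)) (update-self m i y)
             (box⊆U (update m i y) (update-elim (λ j → V j) (univ y) m∈V) i))
      where
      m : Π.Carrier
      m i = proj₁ (ideal-bottom-minimal (P i) (L i) (p i))

      m-minimal : ∀ i {x y} → P._≤_ i (m i) y → P._≤_ i x y → P._≤_ i (m i) x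
      m-minimal i = proj₂ (proj₂ (ideal-bottom-minimal (P i) (L i) (p i)))

      U-open : ScottOpen (ΠPoset P) (λ y → m ≤ y)
      U-open = record
        { upperSet     = λ m≤x x≤y → Π.trans m≤x x≤y
        ; inaccessible = λ D s dir sup m≤s →
            -- Any member of `D` will do: `m i` and `d i` have the common upper bound `s i`, and
            -- `m i` is minimal in the sense of `m-minimal`.
            let d , d∈D = IsDirected.nonempty dir
            in d , d∈D , λ i → m-minimal i (m≤s i) (IsSup.upper sup d∈D i)
        }

    -- Replacing coordinates by least elements outside a finite list.

    restrict : Π.Carrier → List I → Π.Carrier
    restrict x G i with em {P = i ∈ₗ G} | em {P = HasLeast (P i)}
    ... | yes _ | _           = x i
    ... | no _  | yes (b , _) = b
    -- With no least element available the coordinate is kept; the list eventually used contains all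
    -- such `i`.
    ... | no _  | no _        = x i

    restrict-≤ : ∀ x G → restrict x G ≤ x
    restrict-≤ x G i with em {P = i ∈ₗ G} | em {P = HasLeast (P i)}
    ... | yes _ | _               = P.refl i
    ... | no _  | yes (_ , least) = least (x i)
    ... | no _  | no _            = P.refl i

    restrict-∈ : ∀ x {G i} → i ∈ₗ G → restrict x G i ≡ x i
    restrict-∈ x {G} {i} i∈G with em {P = i ∈ₗ G} | em {P = HasLeast (P i)}
    ... | yes _   | _ = refl
    ... | no i∉G  | _ = contradiction i∈G i∉G

    restrict-least : ∀ x {G i} → ¬ i ∈ₗ G → HasLeast (P i) → ∀ y → P._≤_ i (restrict x G i) y
    restrict-least x {G} {i} i∉G has with em {P = i ∈ₗ G} | em {P = HasLeast (P i)}
    ... | yes i∈G | _               = contradiction i∈G i∉G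
    ... | no _    | yes (_ , least) = least
    ... | no _    | no ¬has         = contradiction has ¬has

    restrict-mono : ∀ x {G H} → (∀ {i} → i ∈ₗ G → i ∈ₗ H) → restrict x G ≤ restrict x H
    restrict-mono x {G} {H} G⊆H i
      with em {P = i ∈ₗ G} | em {P = i ∈ₗ H} | em {P = HasLeast (P i)}
    ... | yes _   | yes _  | _               = P.refl i
    ... | yes i∈G | no i∉H | _               = contradiction (G⊆H i∈G) i∉H
    ... | no _    | yes _  | yes (_ , least) = least (x i)
    ... | no _    | yes _  | no _            = P.refl i
    ... | no _    | no _   | yes (_ , least) = P.refl i
    ... | no _    | no _   | no _            = P.refl i

    -- The restrictions of `x` are directed through concatenation of lists, and singleton lists
    -- recover every coordinate, so their supremum is `x`.
    restrict-inaccessible : ∀ {U x} → ScottOpen (ΠPoset P) U → x ∈ U → ∃[ G ] restrict x G ∈ U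
    restrict-inaccessible {U} {x} Uopen x∈U =
      let w , (G , eq) , w∈U = ScottOpen.inaccessible Uopen (λ w → ∃[ G ] w ≡ restrict x G) x
            (record
              { nonempty = restrict x [] , [] , refl
              ; bounded  = λ { (G , refl) (H , refl) → restrict x (G ++ H) , (G ++ H , refl)
                  , restrict-mono x ∈-++⁺ˡ , restrict-mono x (∈-++⁺ʳ G) } })
            (record
              { upper = λ { (G , refl) → restrict-≤ x G }
              ; least = λ {v} above i → subst (λ p → P._≤_ i p (v i)) (restrict-∈ x (here refl))
                  (above (i ∷ [] , refl) i) })
            x∈U
      in G , subst U eq w∈U

    -- The descending sequence inside a Scott open set.

    module _ (count : ∀ i → IsCountable (P i)) (mc : ∀ i → IsMeetContinuousDcpo (P i))
             {U : Pred Π.Carrier ℓ} (Uopen : ScottOpen (ΠPoset P) U) where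

      code : ∀ i → P.Carrier i → ℕ
      code i = Injection.to (count i)

      Task : Set ℓ
      Task = I × ℕ × ℕ × ℕ

      -- A task names s, d, μ only by their codes.  It is void while u i ≰ s, and
      -- comes up again at every later stage.
      Done : (u u′ : Π.Carrier) → Task → Set (Level.suc ℓ)
      Done u u′ (i , a , b , c) =
        ∀ {s d μ} → code i s ≡ a → code i d ≡ b → code i μ ≡ c →
        P._≤_ i (u i) s → Avoidable (P i) s d μ →
        ∃[ m ] P._≤_ i (u′ i) m × Avoids (P i) s d μ m

      -- A task settled between two intermediate points of a descent stays settled between its ends,
      -- so tasks can be performed one after another.
      Done-mono : ∀ {u v u′ v′ t} → v ≤ u → v′ ≤ u′ → Done v u′ t → Done u v′ t
      Done-mono {t = i , _} v≤u v′≤u′ done s d μ u≤s avoidable =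
        let m , u′≤m , avoids = done s d μ (P.trans i (v≤u i) u≤s) avoidable
        in m , P.trans i (v′≤u′ i) u′≤m , avoids

      -- The slice of `U` through `u` is Scott open and contains `s`, so meet-continuity lowers
      -- `u i` below some `e ∈ D` without leaving `U`. A bound of `e` and `d` in `D` then serves as
      -- `m`, since no member of `D` is above `μ`.
      do-task : ∀ {u} → u ∈ U → ∀ t → ∃[ u′ ] u′ ∈ U × u′ ≤ u × Done u u′ t
      do-task {u} u∈U (i , a , b , c)
        with em {P = ∃[ s ] ∃[ d ] ∃[ μ ] code i s ≡ a × code i d ≡ b × code i μ ≡ c ×
                     P._≤_ i (u i) s × Avoidable (P i) s d μ}
      ... | no none = u , u∈U , Π.refl , λ {s} {d} {μ} s≡a d≡b μ≡c u≤s avoidable →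
              contradiction (s , d , μ , s≡a , d≡b , μ≡c , u≤s , avoidable) none
      ... | yes (s , d , μ , s≡a , d≡b , μ≡c , u≤s , D , dir , sup , d∈D , μ≰D) =
        let z , z∈W , z≤u , e , e∈D , z≤e = meet-inaccessible (P i) (mc i) (slice-open Uopen u i)
              dir sup (ScottOpen.upperSet Uopen u∈U self-above) u≤s
            m , m∈D , e≤m , d≤m = IsDirected.bounded dir e∈D d∈D
        in update u i z , z∈W , update-elim (λ j p → P._≤_ j p (u j)) z≤u (λ j → P.refl j)
         -- Codes determine elements up to `≈`, so the `m` found for one triple serves every triple
         -- with these codes.
         , λ s′≡a d′≡b μ′≡c _ _ → m
           , subst (λ p → P._≤_ i p m) (sym (update-self u i z)) (P.trans i z≤e e≤m)
           , P.trans i (same d′≡b d≡b) d≤m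
           , P.trans i (IsSup.upper sup m∈D) (same s≡a s′≡a)
           , λ μ′≤m → μ≰D m∈D (P.trans i (same μ≡c μ′≡c) μ′≤m)
        where
        self-above : u ≤ update u i (u i)
        self-above = update-elim (λ j → P._≤_ j (u j)) (P.refl i) (λ j → P.refl j)
        same : ∀ {x y n} → code i x ≡ n → code i y ≡ n → P._≤_ i x y
        same x≡n y≡n = P.reflexive i (Injection.injective (count i) (trans x≡n (sym y≡n)))

      do-tasks : ∀ {u} → u ∈ U → ∀ ts → ∃[ u′ ] u′ ∈ U × u′ ≤ u × (∀ {t} → t ∈ₗ ts → Done u u′ t)
      do-tasks u∈U []       = _ , u∈U , Π.refl , λ ()
      do-tasks {u} u∈U (t ∷ ts) =
        let v , v∈U , v≤u , doneₜ  = do-task u∈U t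
            w , w∈U , w≤v , doneₜₛ = do-tasks v∈U ts
        in w , w∈U , Π.trans w≤v v≤u , λ
          { (here refl)  → Done-mono {u} {u} {v} {w} Π.refl w≤v doneₜ
          ; (there t∈ts) → Done-mono {u} {v} {w} {w} v≤u Π.refl (doneₜₛ t∈ts) }

      tasks : List I → ℕ → List Task
      tasks F n = cartesianProduct F
        (cartesianProduct (upTo n) (cartesianProduct (upTo n) (upTo n)))

      record Run (F : List I) (u₀ : Π.Carrier) : Set (Level.suc ℓ) where
        field
          u       : ℕ → Π.Carrier
          u∈U     : ∀ n → u n ∈ U
          u-zero  : u 0 ≤ u₀
          u-step  : ∀ n → u (ℕ.suc n) ≤ u n
          u-done  : ∀ n {t} → t ∈ₗ tasks F n → Done (u n) (u (ℕ.suc n)) t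

        u-anti′ : ∀ {k n} → k ≤′ n → u n ≤ u k
        u-anti′ ≤′-refl           = Π.refl
        u-anti′ (≤′-step {n} k≤n) = Π.trans (u-step n) (u-anti′ k≤n)

        u-anti : ∀ {k n} → k ℕ.≤ n → u n ≤ u k
        u-anti k≤n = u-anti′ (≤⇒≤′ k≤n)

      run : ∀ F {u₀} → u₀ ∈ U → Run F u₀
      run F {u₀} u₀∈U = record
        { u      = λ n → proj₁ (stage n)
        ; u∈U    = λ n → proj₂ (stage n)
        ; u-zero = Π.refl
        ; u-step = λ n → proj₁ (proj₂ (proj₂ (do-tasks (proj₂ (stage n)) (tasks F n))))
        ; u-done = λ n → proj₂ (proj₂ (proj₂ (do-tasks (proj₂ (stage n)) (tasks F n))))
        }
        where
        stage : ℕ → ∃[ u ] u ∈ U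
        stage ℕ.zero    = u₀ , u₀∈U
        stage (ℕ.suc n) = let u , u∈U , _ = do-tasks (proj₂ (stage n)) (tasks F n) in u , u∈U

      -- The open box generated by a descending sequence.

      module _ (F : List I) {u₀ : Π.Carrier} (r : Run F u₀)
               (u₀-least : ∀ {i} → ¬ i ∈ₗ F → ∀ y → P._≤_ i (u₀ i) y) where
        open Run r

        V : ∀ i → Pred (P.Carrier i) ℓ
        V i p = ∃[ n ] P._≤_ i (u n i) p

        V-universal : ∀ {i} → ¬ i ∈ₗ F → Universal (V i)
        V-universal {i} i∉F y = 0 , P.trans i (u-zero i) (u₀-least i∉F y)

        V-open : (∀ i → IsLDcpo (P i)) → ∀ i → ScottOpen (P i) (V i)
        V-open L i with em {P = i ∈ₗ F}
        ... | no i∉F = record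
          { upperSet     = λ {_} {y} _ _ → V-universal i∉F y
          ; inaccessible = λ D s dir sup _ →
              let d , d∈D = IsDirected.nonempty dir in d , d∈D , V-universal i∉F d
          }
        ... | yes i∈F = avoiding-filter-open (P i) (count i) (mc i) (L i)
          (λ (n , u≤x) x≤y → n , P.trans i u≤x x≤y)
          (λ (k , u≤x) (n , u≤y) → u (k ⊔ n) i , (k ⊔ n , P.refl i)
            , P.trans i (u-anti (m≤m⊔n k n) i) u≤x
            , P.trans i (u-anti (m≤n⊔m k n) i) u≤y)
          λ {s} {d} {μ} (N , u≤s) avoidable →
            let a = code i s ; b = code i d ; c = code i μ
                -- `K` is at least `N`, so that `u K i ≤ s` and the task is not void, and it exceeds
                -- all three codes, because `upTo K` stops before `K`.
                K = N ⊔ ℕ.suc (a ⊔ (b ⊔ c))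
                abc<K = m≤n⊔m N (ℕ.suc (a ⊔ (b ⊔ c)))
                bc<K  = ℕₚ.≤-trans (ℕ.s≤s (m≤n⊔m a (b ⊔ c))) abc<K
                m , u≤m , avoids = u-done K
                  (∈-cartesianProduct⁺ i∈F
                    (∈-cartesianProduct⁺
                      (∈-upTo⁺ (ℕₚ.≤-trans (ℕ.s≤s (m≤m⊔n a (b ⊔ c))) abc<K))
                    (∈-cartesianProduct⁺
                      (∈-upTo⁺ (ℕₚ.≤-trans (ℕ.s≤s (m≤m⊔n b c)) bc<K))
                      (∈-upTo⁺ (ℕₚ.≤-trans (ℕ.s≤s (m≤n⊔m b c)) bc<K)))))
                  {s} {d} {μ} refl refl refl
                  (P.trans i (u-anti (m≤m⊔n N _) i) u≤s) avoidable
            in m , (ℕ.suc K , u≤m) , avoids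

        common-stage : ∀ {y : Π.Carrier} → (∀ i → y i ∈ V i) → ∀ G →
                       ∃[ n ] (∀ {i} → i ∈ₗ G → P._≤_ i (u n i) (y i))
        common-stage y∈V []      = 0 , λ ()
        common-stage y∈V (i ∷ G) =
          let k , u≤y  = y∈V i
              n , all≤ = common-stage y∈V G
          in k ⊔ n , λ
            { {_} (here refl) → P.trans i (u-anti (m≤m⊔n k n) i) u≤y
            ; {j} (there j∈G) → P.trans j (u-anti (m≤n⊔m k n) j) (all≤ j∈G) }

        -- One stage `n` serves the finitely many coordinates in `F`; elsewhere `u n i` is below the
        -- least element `u₀ i`. Hence `u n ≤ y`.
        box⊆U : ∀ y → (∀ i → y i ∈ V i) → y ∈ U
        box⊆U y y∈V =
          let n , all≤ = common-stage y∈V F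
          in ScottOpen.upperSet Uopen (u∈U n) λ i → below n all≤ i em
          where
          below : ∀ n → (∀ {i} → i ∈ₗ F → P._≤_ i (u n i) (y i)) →
                  ∀ i → Dec (i ∈ₗ F) → P._≤_ i (u n i) (y i)
          below n all≤ i (yes i∈F) = all≤ i∈F
          below n all≤ i (no i∉F)  =
            P.trans i (u-anti {0} {n} ℕ.z≤n i) (P.trans i (u-zero i) (u₀-least i∉F (y i)))

        open-box : (∀ i → IsLDcpo (P i)) → ∀ x → u₀ ≤ x →
          Σ[ V ∈ (∀ i → Pred (P.Carrier i) ℓ) ]
            (∀ i → ScottOpen (P i) (V i)) ×
            IsFinite (λ i → ¬ Universal (V i)) ×
            (∀ i → x i ∈ V i) ×
            (∀ y → (∀ i → y i ∈ V i) → y ∈ U)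
        open-box L x u₀≤x = V , V-open L
          , subset-finite F (λ ¬univ → byContradiction λ i∉F → ¬univ (V-universal i∉F))
          , (λ i → 0 , P.trans i (u-zero i) (u₀≤x i))
          , box⊆U

    scottOpen⇒productOpen :
      (∀ i → IsCountable (P i)) → (∀ i → IsMeetContinuousDcpo (P i)) → (∀ i → IsLDcpo (P i)) →
      IsFinite (NoLeast P) → ScottOpen (ΠPoset P) ⊆ ProductOpen (λ i → ScottOpen (P i))
    scottOpen⇒productOpen count mc L (xs , fin) {U} Uopen x x∈U =
      open-box count mc Uopen F (run count mc Uopen F u₀∈U) u₀-least L x (restrict-≤ x F)
      where
      F : List I
      -- The first part leaves only coordinates with a least element outside `F`; the second keeps
      -- the restriction of `x` in `U`.
      F = xs ++ proj₁ (restrict-inaccessible Uopen x∈U)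

      u₀∈U : restrict x F ∈ U
      u₀∈U = ScottOpen.upperSet Uopen (proj₂ (restrict-inaccessible Uopen x∈U))
               (restrict-mono x (∈-++⁺ʳ xs))

      u₀-least : ∀ {i} → ¬ i ∈ₗ F → ∀ y → P._≤_ i (restrict x F i) y
      u₀-least i∉F = restrict-least x i∉F
        (byContradiction λ none → i∉F (∈-++⁺ˡ (Equivalence.to (fin _) none)))

theorem7p3 : (∀ {a} → ExcludedMiddle a) →
    ∀ {ℓ} →
    ( {I : Set ℓ} (P : I → Poset ℓ ℓ ℓ) →
    (∀ i → Poset.Carrier (P i)) →
    (∀ i → IsCountable (P i)) →
    (∀ i → IsMeetContinuousDcpo (P i)) →
    (∀ i → IsLDcpo (P i)) →
    (ScottOpen (ΠPoset P) ≐ ProductOpen (λ i → ScottOpen (P i))) ⇔ IsFinite (NoLeast P) )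
    ×
    ( {I : Set ℓ} (P : I → Poset ℓ ℓ ℓ) →
    (∀ i → Poset.Carrier (P i)) →
    (∀ i → IsLDcpo (P i)) →
    ScottOpen (ΠPoset P) ≐ ProductOpen (λ i → ScottOpen (P i)) →
    IsFinite (NoLeast P) )
theorem7p3 em =
    (λ P p count mc L → mk⇔
      (noLeast-finite em P p L)
      (λ fin → scottOpen⇒productOpen em P count mc L fin , productOpen⇒scottOpen em P))
  , λ P → noLeast-finite em P
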